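{- Let $n\ge 2$ be an integer. For each natural number $N$, there exist a finite field $\mathbb{F}$ and matrices $A,B\in \mathrm{M}_n(\mathbb{F})$ such that some product in $A,B$ equals the zero matrix $O$ (so that the minimal length of a product in $A,B$ equal to $O$ exists), and this minimal length is greater than $N$.
   Context: $\mathrm{M}_n(\mathbb{F})$ denotes the ring of $n\times n$ matrices over the field $\mathbb{F}$, and $O$ denotes the zero matrix. For matrices $A_1,\dots,A_k\in \mathrm{M}_n(\mathbb{F})$, a product in $A_1,\dots,A_k$ of length $l$ (with $l\ge 1$) is a product $A_{i_1}A_{i_2}\cdots A_{i_l}$ with indices $1\le i_1,\dots,i_l\le k$ not necessarily distinct. -}

module Defs where

open import Level using (suc; _⊔_)
open import Algebra.Bundles using (CommutativeRing)
open import Algebra.Apartness.Bundles using (HeytingField; HeytingCommutativeRing)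
import Algebra.Properties.Semiring.Sum as Sum
open import Data.Nat.Base using (ℕ; _≤_)
open import Data.Fin.Base using (Fin)
open import Data.List.NonEmpty.Base as List⁺ using (List⁺)
open import Data.Product.Base using (_×_; ∃-syntax)
open import Data.Vec.Functional using (Vector)
open import Function.Bundles using (Inverse)
open import Relation.Binary.PropositionalEquality as ≡ using (_≡_)

-- On a finite carrier _≈_ and invertibility are decidable, so tightness of the
-- apartness makes x # y equivalent to ¬ (x ≈ y): every nonzero element is
-- invertible, and 1# ≉ 0# because 1# # 0#.
record FiniteField c ℓ₁ ℓ₂ : Set (suc (c ⊔ ℓ₁ ⊔ ℓ₂)) where
  field
    heytingField : HeytingField c ℓ₁ ℓ₂
  open HeytingField heytingField public
  field
    order  : ℕ
    finite : Inverse setoid (≡.setoid (Fin order))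

  commutativeRing : CommutativeRing c ℓ₁
  commutativeRing = HeytingCommutativeRing.commutativeRing heytingCommutativeRing

module Matrices {c ℓ} (R : CommutativeRing c ℓ) where

  open CommutativeRing R
  open Sum semiring using (sum)

  Matrix : ℕ → Set c
  Matrix n = Vector (Vector Carrier n) n

  infix  4 _≈ᴹ_
  infixl 7 _*ᴹ_

  _≈ᴹ_ : ∀ {n} → Matrix n → Matrix n → Set ℓ
  A ≈ᴹ B = ∀ i j → A i j ≈ B i j

  O : ∀ {n} → Matrix n
  O i j = 0#

  _*ᴹ_ : ∀ {n} → Matrix n → Matrix n → Matrix n
  (A *ᴹ B) i j = sum (λ k → A i k * B k j)

  -- The word i₁ i₂ … iₗ denotes A i₁ *ᴹ A i₂ *ᴹ … *ᴹ A iₗ; words are nonempty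
  -- since products have length at least 1.
  product : ∀ {n k} → Vector (Matrix n) k → List⁺ (Fin k) → Matrix n
  product A w = List⁺.foldr₁ _*ᴹ_ (List⁺.map A w)

  IsMinimalZeroProductLength : ∀ {n k} → Vector (Matrix n) k → ℕ → Set ℓ
  IsMinimalZeroProductLength A l =
    (∃[ w ] List⁺.length w ≡ l × product A w ≈ᴹ O) ×
    (∀ w → product A w ≈ᴹ O → l ≤ List⁺.length w)

{-# OPTIONS --safe #-}

-- Let A be the shear (x , y) ↦ (x + y , y) and B the rank one map (x , y) ↦ (x , x),
-- both extended by zero to n dimensions. Then B A^k B maps (x , y) to
-- ((k + 1) x , (k + 1) x), so over ℤ/p the product B A^(p - 1) B vanishes. Conversely,
-- a word applied to (1 , 0) yields a multiple of (1 , 0) or of (k , 1) with k at most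
-- the length of the word, and only B kills a vector of this kind, for k divisible by p.
module Submission where

open import Defs
open import Level using (0ℓ)
open import Data.Nat.Base using (ℕ; _≤_; _<_)
open import Data.Product.Base using (Σ; _×_; ∃-syntax)
open import Data.Vec.Functional using ([]; _∷_)

open import Algebra.Apartness.Bundles using (HeytingField)
open import Algebra.Bundles using (CommutativeRing)
import Algebra.Properties.Semiring.Mult as Mult
import Algebra.Properties.Semiring.Sum as Sum
open import Algebra.Structures using (IsCommutativeRing)
open import Data.Fin.Base using (Fin; zero; suc; toℕ; fromℕ<)
open import Data.Fin.Patterns using (0F; 1F)
open import Data.Fin.Properties using (toℕ-fromℕ<; toℕ-injective; toℕ<n)
open import Data.Integer.Base as ℤ using (ℤ; +_; 0ℤ; 1ℤ)
import Data.Integer.Divisibility.Signed as ℤ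
import Data.Integer.DivMod as ℤ
import Data.Integer.Properties as ℤ
open import Data.Integer.Tactic.RingSolver using (solve-∀)
import Data.List.Base as List
open import Data.List.NonEmpty.Base as List⁺ using (List⁺; _∷⁺_)
import Data.List.Relation.Unary.All as All
open import Data.Nat.Base using (zero; suc; s≤s; z≤n; _!; NonZero)
import Data.Nat.Base as ℕ
open import Data.Nat.Coprimality using (prime⇒coprime; coprime-Bézout)
open import Data.Nat.Divisibility using (_∣_; ∣-trans; ∣1⇒≡1; ∣m+n∣m⇒∣n; m∣m*n; m≤n⇒m!∣n!; >⇒∤)
open import Data.Nat.GCD using (module Bézout)
open import Data.Nat.ListAction using () renaming (product to productℕ)
open import Data.Nat.Primality using (Prime; ¬prime[1]; prime⇒nonZero; euclidsLemma)
open import Data.Nat.Primality.Factorisation using (factorise)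
import Data.Nat.Properties as ℕ
open import Data.Product.Base using (_,_)
open import Data.Sum.Base using (_⊎_; inj₁; inj₂; [_,_]′)
open import Data.Vec.Functional using (Vector; replicate)
open import Function.Base using (_∘_; _$_)
open import Relation.Binary.PropositionalEquality using (_≡_; refl; sym; trans; cong; subst)
open import Relation.Nullary.Decidable using (Dec; yes; no; map′; decidable-stable)
open import Relation.Nullary.Negation using (¬_; contradiction)

-- Primes beyond any bound.

prime-above : ∀ N → ∃[ p ] Prime p × N < p
prime-above N with factorise (suc (N !))
... | record { factors = List.[]; isFactorisation = eq } =
  contradiction (ℕ.suc-injective eq) (ℕ.≢-nonZero⁻¹ (N !) {{N ℕ.!≢0}})
... | record { factors = p@zero List.∷ ps; factorsPrime = pr All.∷ _ } with () ← prime⇒nonZero pr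
... | record { factors = p@(suc q) List.∷ ps; isFactorisation = eq; factorsPrime = pr All.∷ _ } =
  -- Euclid's argument: a prime factor of `N ! + 1` that is at most `N` would also divide `N !`, and
  -- hence 1.
  p , pr , ℕ.≰⇒> λ p≤N →
    let p∣N! = ∣-trans (m∣m*n (q !)) (m≤n⇒m!∣n! p≤N)
        p∣N!+1 = subst (p ∣_) (sym (trans (ℕ.+-comm (N !) 1) eq)) (m∣m*n (productℕ ps))
    in ¬prime[1] (subst Prime (∣1⇒≡1 (∣m+n∣m⇒∣n p∣N!+1 p∣N!)) pr)

-- Congruence of integers modulo `m`.

module _ (m : ℤ) where

  -- A record rather than a synonym, so that i and j can be inferred.
  record Congruent (i j : ℤ) : Set where
    constructor congruent
    field difference : m ℤ.∣ i ℤ.- j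

module Congruence (m : ℤ) where

  infix 4 _≈_ _≈?_

  _≈_ : ℤ → ℤ → Set
  _≈_ = Congruent m

  open Congruent public

  _≈?_ : ∀ i j → Dec (i ≈ j)
  i ≈? j = map′ congruent difference (m ℤ.∣? i ℤ.- j)

  congruent-by : ∀ {i j d} → d ≡ i ℤ.- j → m ℤ.∣ d → i ≈ j
  congruent-by eq m∣d = congruent (subst (m ℤ.∣_) eq m∣d)

  ≈-reflexive : ∀ {i j} → i ≡ j → i ≈ j
  ≈-reflexive {i} refl = congruent-by (sym (ℤ.+-inverseʳ i)) (ℤ.divides 0ℤ refl)

  ≈-sym : ∀ {i j} → i ≈ j → j ≈ i
  ≈-sym {i} {j} p = congruent-by (eq i j) (ℤ.∣m⇒∣-m (difference p))
    where
    eq : ∀ i j → ℤ.- (i ℤ.- j) ≡ j ℤ.- i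
    eq = solve-∀

  ≈-trans : ∀ {i j k} → i ≈ j → j ≈ k → i ≈ k
  ≈-trans {i} {j} {k} p q = congruent-by (eq i j k) (ℤ.∣m∣n⇒∣m+n (difference p) (difference q))
    where
    eq : ∀ i j k → (i ℤ.- j) ℤ.+ (j ℤ.- k) ≡ i ℤ.- k
    eq = solve-∀

  +-cong : ∀ {i j k l} → i ≈ j → k ≈ l → i ℤ.+ k ≈ j ℤ.+ l
  +-cong {i} {j} {k} {l} p q =
    congruent-by (eq i j k l) (ℤ.∣m∣n⇒∣m+n (difference p) (difference q))
    where
    eq : ∀ i j k l → (i ℤ.- j) ℤ.+ (k ℤ.- l) ≡ (i ℤ.+ k) ℤ.- (j ℤ.+ l)
    eq = solve-∀

  *-cong : ∀ {i j k l} → i ≈ j → k ≈ l → i ℤ.* k ≈ j ℤ.* l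
  *-cong {i} {j} {k} {l} p q = congruent-by (eq i j k l)
    (ℤ.∣m∣n⇒∣m+n (ℤ.∣m⇒∣m*n k (difference p)) (ℤ.∣n⇒∣m*n j (difference q)))
    where
    eq : ∀ i j k l → (i ℤ.- j) ℤ.* k ℤ.+ j ℤ.* (k ℤ.- l) ≡ i ℤ.* k ℤ.- j ℤ.* l
    eq = solve-∀

  neg-cong : ∀ {i j} → i ≈ j → ℤ.- i ≈ ℤ.- j
  neg-cong {i} {j} p = congruent-by (eq i j) (ℤ.∣m⇒∣-m (difference p))
    where
    eq : ∀ i j → ℤ.- (i ℤ.- j) ≡ ℤ.- i ℤ.- ℤ.- j
    eq = solve-∀

  -- The carrier stays ℤ and only equality is coarsened, so every ring law is inherited from ℤ; just
  -- the compatibility of the operations with congruence is new.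
  isCommutativeRing : IsCommutativeRing _≈_ ℤ._+_ ℤ._*_ ℤ.-_ 0ℤ 1ℤ
  isCommutativeRing = record
    { isRing = record
      { +-isAbelianGroup = record
        { isGroup = record
          { isMonoid = record
            { isSemigroup = record
              { isMagma = record
                { isEquivalence = record { refl = ≈-reflexive refl; sym = ≈-sym; trans = ≈-trans }
                ; ∙-cong = +-cong
                }
              ; assoc = λ i j k → ≈-reflexive (ℤ.+-assoc i j k)
              }
            ; identity = ≈-reflexive ∘ ℤ.+-identityˡ , ≈-reflexive ∘ ℤ.+-identityʳ
            }
          ; inverse = ≈-reflexive ∘ ℤ.+-inverseˡ , ≈-reflexive ∘ ℤ.+-inverseʳ
          ; ⁻¹-cong = neg-cong
          }
        ; comm = λ i j → ≈-reflexive (ℤ.+-comm i j)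
        }
      ; *-cong = *-cong
      ; *-assoc = λ i j k → ≈-reflexive (ℤ.*-assoc i j k)
      ; *-identity = ≈-reflexive ∘ ℤ.*-identityˡ , ≈-reflexive ∘ ℤ.*-identityʳ
      ; distrib = (λ i j k → ≈-reflexive (ℤ.*-distribˡ-+ i j k))
                , (λ i j k → ≈-reflexive (ℤ.*-distribʳ-+ i j k))
      }
    ; *-comm = λ i j → ≈-reflexive (ℤ.*-comm i j)
    }

  modulus≈0 : m ≈ 0ℤ
  modulus≈0 = congruent-by (sym (ℤ.+-identityʳ m)) ℤ.∣-refl

  ≈0⇒∣ : ∀ {i} → i ≈ 0ℤ → m ℤ.∣ i
  ≈0⇒∣ {i} p = subst (m ℤ.∣_) (ℤ.+-identityʳ i) (difference p)

  ∣⇒≈0 : ∀ {i} → m ℤ.∣ i → i ≈ 0ℤ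
  ∣⇒≈0 {i} = congruent-by (sym (ℤ.+-identityʳ i))

  ≈⇒-≈0 : ∀ {i j} → i ≈ j → i ℤ.- j ≈ 0ℤ
  ≈⇒-≈0 = ∣⇒≈0 ∘ difference

  -≈0⇒≈ : ∀ {i j} → i ℤ.- j ≈ 0ℤ → i ≈ j
  -≈0⇒≈ = congruent ∘ ≈0⇒∣

-- Canonical residues modulo a nonzero `n`.

module Residues (n : ℕ) .{{_ : NonZero n}} where

  open Congruence (+ n)

  i%n≈i : ∀ i → + (i ℤ.%ℕ n) ≈ i
  i%n≈i i = ≈-sym $ congruent-by eq (ℤ.∣n⇒∣m*n (i ℤ./ℕ n) ℤ.∣-refl)
    where
    cancel : ∀ r q → q ≡ (r ℤ.+ q) ℤ.- r
    cancel = solve-∀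
    eq : (i ℤ./ℕ n) ℤ.* + n ≡ i ℤ.- + (i ℤ.%ℕ n)
    eq = trans (cancel (+ (i ℤ.%ℕ n)) _) (cong (ℤ._- + (i ℤ.%ℕ n)) (sym (ℤ.a≡a%ℕn+[a/ℕn]*n i n)))

  -- The distance between `r` and `s` is at most their maximum, hence below `n`, and the only
  -- multiple of `n` that small is 0.
  ≈⇒≡ : ∀ {r s} → r < n → s < n → + r ≈ + s → r ≡ s
  ≈⇒≡ {r} {s} r<n s<n r≈s =
    ℤ.+-injective (ℤ.i-j≡0⇒i≡j (+ r) (+ s)
      (ℤ.∣i∣≡0⇒i≡0 (small (ℤ.∣⇒∣ᵤ (difference r≈s)) bound)))
    where
    bound : ℤ.∣ + r ℤ.- + s ∣ < n
    bound rewrite ℤ.m-n≡m⊖n r s = ℕ.≤-<-trans (ℤ.∣m⊝n∣≤m⊔n r s) (ℕ.⊔-lub r<n s<n)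
    small : ∀ {d} → n ∣ d → d < n → d ≡ 0
    small {zero} _ _ = refl
    small {suc d} n∣d d<n = contradiction n∣d (>⇒∤ d<n)

  residue : ℤ → Fin n
  residue i = fromℕ< (ℤ.n%ℕd<d i n)

  residue≈ : ∀ i → + toℕ (residue i) ≈ i
  residue≈ i = ≈-trans (≈-reflexive (cong +_ (toℕ-fromℕ< _))) (i%n≈i i)

  residue-unique : ∀ {i} {r : Fin n} → i ≈ + toℕ r → residue i ≡ r
  residue-unique {r = r} i≈r =
    toℕ-injective (≈⇒≡ (toℕ<n _) (toℕ<n r) (≈-trans (residue≈ _) i≈r))

-- The field of integers modulo a prime.

module PrimeField (p : ℕ) (pr : Prime p) where

  instance
    p≢0 : NonZero p
    p≢0 = prime⇒nonZero pr

  open Congruence (+ p) public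
  open Residues p public

  1≉0 : ¬ 1ℤ ≈ 0ℤ
  1≉0 1≈0 = ¬prime[1] (subst Prime (∣1⇒≡1 (ℤ.∣⇒∣ᵤ (≈0⇒∣ 1≈0))) pr)

  -- Since `r` is coprime to `p`, its coefficient in a Bézout identity inverts it modulo `p`. Over ℕ
  -- the identity comes in two forms; the one with `1 + y r = x p` yields the inverse `- y`.
  inverseℕ : ∀ r .{{_ : NonZero r}} → r < p → ∃[ y ] y ℤ.* + r ≈ 1ℤ
  inverseℕ r r<p with coprime-Bézout (prime⇒coprime pr r<p)
  ... | Bézout.+- x y 1+yr≡xp = ℤ.- + y , ≈-sym (congruent-by eq (ℤ.∣n⇒∣m*n (+ x) ℤ.∣-refl))
    where
    rearrange : ∀ y r → 1ℤ ℤ.+ y ℤ.* r ≡ 1ℤ ℤ.- ℤ.- y ℤ.* r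
    rearrange = solve-∀
    eq : + x ℤ.* + p ≡ 1ℤ ℤ.- ℤ.- + y ℤ.* + r
    eq = trans (sym (ℤ.pos-* x p)) (trans (cong +_ (sym 1+yr≡xp))
      (trans (cong (λ j → 1ℤ ℤ.+ j) (ℤ.pos-* y r)) (rearrange (+ y) (+ r))))
  ... | Bézout.-+ x y 1+xp≡yr = + y , congruent-by eq (ℤ.∣n⇒∣m*n (+ x) ℤ.∣-refl)
    where
    rearrange : ∀ q → q ≡ (1ℤ ℤ.+ q) ℤ.- 1ℤ
    rearrange = solve-∀
    eq : + x ℤ.* + p ≡ + y ℤ.* + r ℤ.- 1ℤ
    eq = trans (rearrange (+ x ℤ.* + p)) (cong (ℤ._- 1ℤ)
      (trans (cong (λ j → 1ℤ ℤ.+ j) (sym (ℤ.pos-* x p))) (trans (cong +_ 1+xp≡yr) (ℤ.pos-* y r))))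

  inverse : ∀ {i} → ¬ i ≈ 0ℤ → ∃[ y ] y ℤ.* i ≈ 1ℤ
  inverse {i} i≉0 = let y , yr≈1 = inverseℕ r {{r≢0}} (ℤ.n%ℕd<d i p)
                    in y , ≈-trans (*-cong (≈-reflexive {y} refl) (≈-sym (i%n≈i i))) yr≈1
    where
    r = i ℤ.%ℕ p
    r≢0 : NonZero r
    r≢0 = ℕ.≢-nonZero λ r≡0 → i≉0 (≈-trans (≈-sym (i%n≈i i)) (≈-reflexive (cong +_ r≡0)))

  -- Apartness is the negation of congruence; cotransitivity and tightness follow because congruence
  -- is decidable.
  heytingField : HeytingField 0ℓ 0ℓ 0ℓ
  heytingField = record
    { _≈_ = _≈_
    ; _#_ = λ i j → ¬ i ≈ j
    ; isHeytingField = record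
      { isHeytingCommutativeRing = record
        { isCommutativeRing = isCommutativeRing
        ; isApartnessRelation = record
          { irrefl = λ i≈j i≉j → i≉j i≈j
          ; sym = λ i≉j → i≉j ∘ ≈-sym
          ; cotrans = cotrans
          }
        ; #⇒invertible = λ i≉j → let y , yd≈1 = inverse (i≉j ∘ -≈0⇒≈)
                                 in y , yd≈1 , ≈-trans (≈-reflexive (ℤ.*-comm _ y)) yd≈1
        ; invertible⇒# = λ { (y , yd≈1 , _) i≈j → 1≉0 $ ≈-trans (≈-sym yd≈1) $
            ≈-trans (*-cong (≈-reflexive {y} refl) (≈⇒-≈0 i≈j)) (≈-reflexive (ℤ.*-zeroʳ y)) }
        }
      ; tight = λ i j → decidable-stable (i ≈? j) , λ i≈j i≉j → i≉j i≈j
      }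
    }
    where
    cotrans : ∀ {i j} → ¬ i ≈ j → ∀ k → ¬ i ≈ k ⊎ ¬ k ≈ j
    cotrans {i} i≉j k with i ≈? k
    ... | yes i≈k = inj₂ (i≉j ∘ ≈-trans i≈k)
    ... | no i≉k = inj₁ i≉k

  finiteField : FiniteField 0ℓ 0ℓ 0ℓ
  finiteField = record
    { heytingField = heytingField
    ; order = p
    ; finite = record
      { to = residue
      ; from = +_ ∘ toℕ
      ; to-cong = λ {i} {j} i≈j → residue-unique (≈-trans i≈j (≈-sym (residue≈ j)))
      ; from-cong = ≈-reflexive ∘ cong (+_ ∘ toℕ)
      ; inverse = residue-unique
                , λ { {i} refl → residue≈ i }
      }
    }

  open CommutativeRing (FiniteField.commutativeRing finiteField) using (semiring)
  open Mult semiring using () renaming (_×_ to _·_)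

  ·≡* : ∀ k i → k · i ≡ + k ℤ.* i
  ·≡* zero i = refl
  ·≡* (suc k) i = trans (cong (λ j → i ℤ.+ j) (·≡* k i)) (sym (ℤ.suc-* (+ k) i))

  p·i≈0 : ∀ i → p · i ≈ 0ℤ
  p·i≈0 i = ≈-trans (≈-reflexive (·≡* p i)) (*-cong modulus≈0 (≈-reflexive {i} refl))

  -- Divisibility of `k · i` by `p` passes to one of the factors by Euclid's lemma, and `k` is
  -- positive but too small.
  ·-torsionFree : ∀ k .{{_ : NonZero k}} {i} → k < p → k · i ≈ 0ℤ → i ≈ 0ℤ
  ·-torsionFree k {i} k<p ki≈0 =
    [ (λ p∣k → contradiction p∣k (>⇒∤ k<p)) , ∣⇒≈0 ∘ ℤ.∣ᵤ⇒∣ ]′ (euclidsLemma k ℤ.∣ i ∣ pr p∣k*∣i∣)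
    where
    p∣k*∣i∣ : p ∣ k ℕ.* ℤ.∣ i ∣
    p∣k*∣i∣ = subst (p ∣_) (trans (cong ℤ.∣_∣ (·≡* k i)) (ℤ.abs-* (+ k) i)) (ℤ.∣⇒∣ᵤ (≈0⇒∣ ki≈0))

-- The two matrices and the vanishing product.

module ShearAndRankOne {c ℓ} (R : CommutativeRing c ℓ) (m : ℕ) where

  open CommutativeRing R renaming (refl to ≈-refl; sym to ≈-sym; trans to ≈-trans) hiding (zero)
  open Sum semiring using (sum; sum-cong-≋; sum-replicate-zero)
  open Mult semiring using (×-homo-1; ×-congʳ) renaming (_×_ to _·_)
  open Matrices R

  row : Carrier → Carrier → Vector Carrier (2 ℕ.+ m)
  row a b = a ∷ b ∷ replicate m 0#

  A B : Matrix (2 ℕ.+ m)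
  A = row 1# 1# ∷ row 0# 1# ∷ λ _ _ → 0#
  B = row 1# 0# ∷ row 1# 0# ∷ λ _ _ → 0#

  sum-0* : ∀ {n} (x : Vector Carrier n) → sum (λ k → 0# * x k) ≈ 0#
  sum-0* {n} x = ≈-trans (sum-cong-≋ (λ k → zeroˡ (x k))) (sum-replicate-zero n)

  sum-row : ∀ a b (x : Vector Carrier (2 ℕ.+ m)) →
            sum (λ k → row a b k * x k) ≈ a * x 0F + b * x 1F
  sum-row a b x = +-congˡ (≈-trans (+-congˡ (sum-0* (λ k → x (suc (suc k))))) (+-identityʳ _))

  A*-0 : ∀ X j → (A *ᴹ X) 0F j ≈ X 0F j + X 1F j
  A*-0 X j = ≈-trans (sum-row 1# 1# (λ k → X k j)) (+-cong (*-identityˡ _) (*-identityˡ _))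

  A*-1 : ∀ X j → (A *ᴹ X) 1F j ≈ X 1F j
  A*-1 X j = ≈-trans (sum-row 0# 1# (λ k → X k j))
    (≈-trans (+-cong (zeroˡ _) (*-identityˡ _)) (+-identityˡ _))

  sum-row10 : (x : Vector Carrier (2 ℕ.+ m)) → sum (λ k → row 1# 0# k * x k) ≈ x 0F
  sum-row10 x = ≈-trans (sum-row 1# 0# x) (≈-trans (+-cong (*-identityˡ _) (zeroˡ _)) (+-identityʳ _))

  -- Rows `0F` and `1F` of `B *ᴹ X` are both copies of the top row of `X`, and all other rows of `B`
  -- are zero.
  B*-zero : ∀ X → (∀ j → X 0F j ≈ 0#) → B *ᴹ X ≈ᴹ O
  B*-zero X X₀≈0 0F j = ≈-trans (sum-row10 (λ k → X k j)) (X₀≈0 j)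
  B*-zero X X₀≈0 1F j = ≈-trans (sum-row10 (λ k → X k j)) (X₀≈0 j)
  B*-zero X X₀≈0 (suc (suc i)) j = sum-0* (λ k → X k j)

  ⟦_⟧ : List⁺ (Fin 2) → Matrix (2 ℕ.+ m)
  ⟦_⟧ = product (A ∷ B ∷ [])

  AᵏB : ℕ → List⁺ (Fin 2)
  AᵏB zero = 1F List⁺.∷ List.[]
  AᵏB (suc k) = 0F ∷⁺ AᵏB k

  length-AᵏB : ∀ k → List⁺.length (AᵏB k) ≡ suc k
  length-AᵏB zero = refl
  length-AᵏB (suc k) = cong suc (length-AᵏB k)

  AᵏB-1 : ∀ k j → ⟦ AᵏB k ⟧ 1F j ≈ B 0F j
  AᵏB-1 zero j = ≈-refl
  AᵏB-1 (suc k) j = ≈-trans (A*-1 ⟦ AᵏB k ⟧ j) (AᵏB-1 k j)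

  -- Each factor `A` adds the second row, which stays equal to the top row of `B`, to the first. The
  -- count starts at 1 because `B` itself already contributes that row once.
  AᵏB-0 : ∀ k j → ⟦ AᵏB k ⟧ 0F j ≈ suc k · B 0F j
  AᵏB-0 zero j = ≈-sym (×-homo-1 _)
  AᵏB-0 (suc k) j = ≈-trans (A*-0 ⟦ AᵏB k ⟧ j) (≈-trans (+-cong (AᵏB-0 k j) (AᵏB-1 k j)) (+-comm _ _))

  -- The nonzero vectors reached from (1 , 0) by words of length l.
  data Reached (l : ℕ) (x y : Carrier) : Set ℓ where
    axis  : ¬ x ≈ 0# → y ≈ 0# → Reached l x y
    slope : ∀ k → k < l → x ≈ suc k · y → ¬ y ≈ 0# → Reached l x y

  Reached⇒nonzero : ∀ {l x y} → Reached l x y → x ≈ 0# → ¬ y ≈ 0#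
  Reached⇒nonzero (axis x≉0 _) x≈0 _ = x≉0 x≈0
  Reached⇒nonzero (slope _ _ _ y≉0) _ y≈0 = y≉0 y≈0

  -- Minimality, when `suc q` is the additive order of every nonzero element.

  module _ (1≉0 : ¬ 1# ≈ 0#) (q : ℕ) (torsion : ∀ x → suc q · x ≈ 0#)
           (torsionFree : ∀ k {x} → k < q → suc k · x ≈ 0# → x ≈ 0#) where

    -- The shear fixes the axis and raises the multiplier of a slope vector by one, in step with the
    -- word length.
    reached-A : ∀ {l x y x′ y′} → x′ ≈ x + y → y′ ≈ y → Reached l x y → Reached (suc l) x′ y′
    reached-A x′≈ y′≈ (axis x≉0 y≈0) = axis
      (λ x′≈0 → x≉0 (≈-trans (≈-sym (+-identityʳ _)) (≈-trans (+-congˡ (≈-sym y≈0)) (≈-trans (≈-sym x′≈) x′≈0))))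
      (≈-trans y′≈ y≈0)
    reached-A x′≈ y′≈ (slope k k<l x≈ y≉0) = slope (suc k) (s≤s k<l)
      (≈-trans x′≈ (≈-trans (+-comm _ _) (≈-trans (+-congˡ x≈) (×-congʳ (suc (suc k)) (≈-sym y′≈)))))
      (y≉0 ∘ ≈-trans (≈-sym y′≈))

    -- The multiplier `suc k` is at most `l`, hence at most `q`, so the first coordinate is nonzero.
    -- Applying `B` then resets the multiplier to 1, that is, `k` to 0.
    reached-B : ∀ {l x y x′ y′} → l ≤ q → x′ ≈ x → y′ ≈ x → Reached l x y → Reached (suc l) x′ y′
    reached-B {x = x} l≤q x′≈ y′≈ r = slope 0 (s≤s z≤n)
      (≈-trans x′≈ (≈-trans (≈-sym y′≈) (≈-sym (×-homo-1 _))))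
      (x≉0 r ∘ ≈-trans (≈-sym y′≈))
      where
      x≉0 : Reached _ x _ → ¬ x ≈ 0#
      x≉0 (axis x≉0 _) = x≉0
      x≉0 (slope k k<l x≈ y≉0) x≈0 =
        y≉0 (torsionFree k (ℕ.<-≤-trans k<l l≤q) (≈-trans (≈-sym x≈) x≈0))

    -- Column `0F` of a product is the image of (1 , 0). The induction peels off the leftmost
    -- letter, which acts last; the one-letter words give (1 , 0) for `A` and (1 , 1) for `B`.
    reached : ∀ i w → List.length w ≤ q →
              Reached (suc (List.length w)) (⟦ i List⁺.∷ w ⟧ 0F 0F) (⟦ i List⁺.∷ w ⟧ 1F 0F)
    reached 0F List.[] _ = axis 1≉0 ≈-refl
    reached 1F List.[] _ = slope 0 (s≤s z≤n) (≈-sym (×-homo-1 _)) 1≉0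
    reached 0F (i List.∷ w) l<q =
      reached-A (A*-0 ⟦ i List⁺.∷ w ⟧ 0F) (A*-1 ⟦ i List⁺.∷ w ⟧ 0F) (reached i w (ℕ.<⇒≤ l<q))
    reached 1F (i List.∷ w) l<q =
      reached-B l<q (sum-row10 column) (sum-row10 column) (reached i w (ℕ.<⇒≤ l<q))
      where column = λ k → ⟦ i List⁺.∷ w ⟧ k 0F

    minimal : IsMinimalZeroProductLength (A ∷ B ∷ []) (2 ℕ.+ q)
    minimal =
      -- The witness is B A^q B: the top row of A^q B is `suc q` times that of `B`, which vanishes
      -- by torsion, and the left factor `B` sees only that row.
      ( 1F ∷⁺ AᵏB q
      , cong suc (length-AᵏB q)
      , B*-zero ⟦ AᵏB q ⟧ (λ j → ≈-trans (AᵏB-0 q j) (torsion _)) )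
      -- A word of length at most `suc q` has a tail of length at most `q`, so its first column is
      -- nonzero.
      , λ (i List⁺.∷ w) w≈O → s≤s $ ℕ.≰⇒> λ l≤q → Reached⇒nonzero (reached i w l≤q) (w≈O 0F 0F) (w≈O 1F 0F)

theorem4 : (n : ℕ) → 2 ≤ n → (N : ℕ) →
    Σ (FiniteField 0ℓ 0ℓ 0ℓ) (λ F →
    let open Matrices (FiniteField.commutativeRing F) in
    Σ (Matrix n) (λ A → Σ (Matrix n) (λ B →
    ∃[ l ] IsMinimalZeroProductLength (A ∷ B ∷ []) l × N < l)))
theorem4 (suc (suc m)) (s≤s (s≤s z≤n)) N with prime-above N
... | suc q , pr , N<p =
  -- With the prime p = `suc q`, the minimal length is p + 1.
  finiteField , A , B , 2 ℕ.+ q ,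
  minimal 1≉0 q p·i≈0 (λ k k<q → ·-torsionFree (suc k) (s≤s k<q)) ,
  ℕ.m<n⇒m<1+n N<p
  where
  open PrimeField (suc q) pr
  open ShearAndRankOne (FiniteField.commutativeRing finiteField) m
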